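{- Let $n,a$ be integers with $n\ge 1$ and $1\le a\le n$. Then $$\begin{aligned}[F_{n+1}]_{q} ={}& q^{F_{a+1}F_{n-a+1}}[F_{n-a}]_{q^{F_{a}}}\,[F_{a}]_{q}\\ &+[F_{a}]_{q}\sum_{i=1}^{\lfloor n/a\rfloor-1}\left\{ q^{F_{a+1}F_{n-(i+1)a+1}}\left(\prod_{j=1}^{i}[F_{a+1}]_{q^{F_{n-ja+1}}}\right)[F_{n-(i+1)a}]_{q^{F_{a}}}\right\}\\ &+\left(\prod_{j=1}^{\lfloor n/a\rfloor}[F_{a+1}]_{q^{F_{n-ja+1}}}\right)\left[F_{n-\lfloor n/a\rfloor a+1}\right]_{q}.\end{aligned}$$
   Context: Fibonacci numbers: $F_0=0$, $F_1=1$, $F_n=F_{n-1}+F_{n-2}$. For an integer $m\ge 0$, $[m]_q=\sum_{i=0}^{m-1}q^i$ (so $[0]_q=0$), with $q$ an indeterminate, and $[m]_{q^s}=\sum_{i=0}^{m-1}q^{si}$ for an integer $s\ge 0$. Empty sums are $0$ and empty products are $1$. -}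

module Defs where

open import Algebra.Bundles using (RawSemiring)
import Algebra.Definitions.RawSemiring as RawSemiringDefs
open import Data.Fin.Base using (toℕ)
open import Data.Integer.Base as ℤ using (ℤ; 0ℤ; 1ℤ)
open import Data.List.Base using (List; []; _∷_; map)
open import Data.Nat.Base as ℕ using (ℕ; zero; suc)
open import Level using (0ℓ)
open import Relation.Binary.PropositionalEquality.Core using (_≡_)

F : ℕ → ℕ
F zero          = 0
F (suc zero)    = 1
F (suc (suc n)) = F (suc n) ℕ.+ F n

-- A polynomial in ℤ[q] is its list of coefficients, constant term first.
-- Trailing zeros are allowed, so polynomials are compared by _≈_ rather
-- than by _≡_.

ℤ[q] : Set
ℤ[q] = List ℤ

coeff : ℤ[q] → ℕ → ℤ
coeff []      _       = 0ℤ
coeff (c ∷ _) zero    = c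
coeff (_ ∷ p) (suc k) = coeff p k

infix  4 _≈_
infixl 6 _⊕_
infixl 7 _⊗_

_≈_ : ℤ[q] → ℤ[q] → Set
p ≈ r = ∀ k → coeff p k ≡ coeff r k

_⊕_ : ℤ[q] → ℤ[q] → ℤ[q]
[]      ⊕ r       = r
p       ⊕ []      = p
(c ∷ p) ⊕ (d ∷ r) = (c ℤ.+ d) ∷ (p ⊕ r)

-- (c + q p) r = c r + q (p r)
_⊗_ : ℤ[q] → ℤ[q] → ℤ[q]
[]      ⊗ r = []
(c ∷ p) ⊗ r = map (c ℤ.*_) r ⊕ (0ℤ ∷ (p ⊗ r))

q : ℤ[q]
q = 0ℤ ∷ 1ℤ ∷ []

ℤ[q]-rawSemiring : RawSemiring 0ℓ 0ℓ
ℤ[q]-rawSemiring = record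
  { Carrier = ℤ[q]
  ; _≈_     = _≈_
  ; _+_     = _⊕_
  ; _*_     = _⊗_
  ; 0#      = []
  ; 1#      = 1ℤ ∷ []
  }

open RawSemiringDefs ℤ[q]-rawSemiring public using (_^_; sum; product)

-- The library's sum and product run over Fin N = {0, …, N - 1}; these run
-- over 1, …, N.

∑₁ : ℕ → (ℕ → ℤ[q]) → ℤ[q]
∑₁ N f = sum {N} (λ i → f (suc (toℕ i)))

∏₁ : ℕ → (ℕ → ℤ[q]) → ℤ[q]
∏₁ N f = product {N} (λ j → f (suc (toℕ j)))

syntax ∑₁ N (λ i → e) = ∑[1≤ i ≤ N ] e
syntax ∏₁ N (λ j → e) = ∏[1≤ j ≤ N ] e

infix 9 [_]q [_]q^_

[_]q : ℕ → ℤ[q]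
[ m ]q = sum {m} (λ i → q ^ toℕ i)

[_]q^_ : ℕ → ℕ → ℤ[q]
[ m ]q^ s = sum {m} (λ i → q ^ (s ℕ.* toℕ i))

{-# OPTIONS --safe #-}

-- In q-analogue form, via [x + y] = [x] + q^x [y] and [x y] = [x] [y]_{q^x}, the
-- addition formula F (a + m + 1) = F (a + 1) F (m + 1) + F a F m expresses
-- [F (n + 1)] through [F (n - a + 1)].  Applying this successively to n, n - a,
-- n - 2a, …, ⌊n/a⌋ times in all, gives the formula.

module Submission where

open import Defs
open import Data.Nat.Base using (ℕ; _+_; _*_; _∸_; _≤_; _/_; >-nonZero)

open import Algebra.Bundles using (CommutativeSemiring; Monoid)
import Algebra.Properties.Monoid.Sum as MonoidSum
import Algebra.Properties.Semiring.Exp as SemiringExp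
import Algebra.Properties.Semiring.Sum as SemiringSum
open import Algebra.Structures.Biased using (isCommutativeSemiringˡ)
import Algebra.Solver.Ring.NaturalCoefficients.Default as SemiringSolver
open import Data.Fin.Base using (toℕ)
open import Data.Fin.Properties using (toℕ-fromℕ; toℕ-inject₁)
open import Data.Integer.Base as ℤ using (0ℤ; 1ℤ)
import Data.Integer.Properties as ℤ
open import Data.Integer.Tactic.RingSolver as ℤ-Solver using ()
open import Data.List.Base using ([]; _∷_; map)
open import Data.Nat.Base using (zero; suc)
open import Data.Nat.DivMod using (m/n*n≤m; m≥n⇒m/n>0)
import Data.Nat.Properties as ℕ
open import Data.Nat.Tactic.RingSolver as ℕ-Solver using ()
open import Data.Product.Base using (_,_)
open import Level using (0ℓ)
open import Relation.Binary.Structures using (IsEquivalence)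
open import Relation.Binary.PropositionalEquality as ≡ using (_≡_; cong; cong₂; subst)

-- Addition formula for Fibonacci numbers.

-- Induction on `n` with `m` free: moving one unit from the second summand to the first turns
-- `n + 2` into `n + 1`, and the recurrence regroups the products.
F-add : ∀ m n → F (m + suc n) ≡ F (suc m) * F (suc n) + F m * F n
F-add m zero    = ≡.trans (cong F (ℕ.+-comm m 1)) (lemma (F (suc m)) (F m))
  where
  lemma : ∀ x y → x ≡ x * 1 + y * 0
  lemma = ℕ-Solver.solve-∀
F-add m (suc n) = begin
  F (m + suc (suc n))                            ≡⟨ cong F (ℕ.+-suc m (suc n)) ⟩
  F (suc m + suc n)                              ≡⟨ F-add (suc m) n ⟩
  (F (suc m) + F m) * F (suc n) + F (suc m) * F n ≡⟨ lemma (F (suc m)) (F m) (F (suc n)) (F n) ⟩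
  F (suc m) * (F (suc n) + F n) + F m * F (suc n) ∎
  where
  open ≡.≡-Reasoning
  lemma : ∀ u v x y → (u + v) * x + u * y ≡ u * (x + y) + v * x
  lemma = ℕ-Solver.solve-∀

F-split : ∀ {a n} → a ≤ n →
          F (n + 1) ≡ F (a + 1) * F (n ∸ a + 1) + F a * F (n ∸ a)
F-split {a} {n} a≤n
  rewrite ℕ.+-comm a 1 | ℕ.+-comm (n ∸ a) 1 = begin
  F (n + 1)             ≡⟨ cong (λ k → F (k + 1)) (ℕ.m+[n∸m]≡n a≤n) ⟨
  F (a + (n ∸ a) + 1)   ≡⟨ cong F (≡.trans (ℕ.+-assoc a (n ∸ a) 1) (cong (a +_) (ℕ.+-comm (n ∸ a) 1))) ⟩
  F (a + suc (n ∸ a))   ≡⟨ F-add a (n ∸ a) ⟩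
  F (suc a) * F (suc (n ∸ a)) + F a * F (n ∸ a) ∎
  where open ≡.≡-Reasoning

-- Splitting off the last term.

-- `sum` unfolds from the front, whereas the expansion below grows at the end. Over an arbitrary
-- monoid, one lemma serves both sums and products.
module LastTerm {c ℓ} (M : Monoid c ℓ) where
  open Monoid M renaming (Carrier to A; _∙_ to _⊹_; _≈_ to _≋_)
  open MonoidSum M using (sum-init-last; sum-cong-≗) renaming (sum to ∑)

  sum-last : ∀ N (f : ℕ → A) →
             ∑ {suc N} (λ i → f (toℕ i)) ≋ ∑ {N} (λ i → f (toℕ i)) ⊹ f N
  sum-last N f = trans (sum-init-last {N} (λ i → f (toℕ i)))
    (reflexive (cong₂ _⊹_ (sum-cong-≗ {N} (λ i → cong f (toℕ-inject₁ i)))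
                          (cong f (toℕ-fromℕ N))))

-- q-integers in a commutative semiring.

module QFibonacci {c ℓ} (R : CommutativeSemiring c ℓ)
                  (x : CommutativeSemiring.Carrier R) where

  open CommutativeSemiring R
    renaming (Carrier to A; _+_ to _⊹_; _*_ to _·_; _≈_ to _≋_)
  open SemiringExp semiring
    using (^-congʳ; ^-homo-*) renaming (_^_ to _↑_)
  open SemiringSum semiring using (sum-cong-≋; *-distribˡ-sum) renaming (sum to ∑)
  open MonoidSum *-monoid using () renaming (sum to ∏)
  open SemiringSolver R using (solve; _:+_; _:*_; _:=_; con)
  open import Relation.Binary.Reasoning.Setoid setoid

  infix 9 ⟦_⟧ ⟦_⟧^_

  ⟦_⟧ : ℕ → A
  ⟦ m ⟧ = ∑ {m} (λ i → x ↑ toℕ i)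

  ⟦_⟧^_ : ℕ → ℕ → A
  ⟦ m ⟧^ s = ∑ {m} (λ i → x ↑ (s * toℕ i))

  ⟦⟧^-suc : ∀ s m → ⟦ suc m ⟧^ s ≋ 1# ⊹ x ↑ s · ⟦ m ⟧^ s
  -- The first exponent is `s * 0`, which does not reduce to `0` for a variable `s`.
  ⟦⟧^-suc s m = +-cong (^-congʳ x (ℕ.*-zeroʳ s)) (begin
    ∑ {m} (λ i → x ↑ (s * suc (toℕ i)))     ≈⟨ sum-cong-≋ {m} (λ i → ^-congʳ x (ℕ.*-suc s (toℕ i))) ⟩
    ∑ {m} (λ i → x ↑ (s + s * toℕ i))       ≈⟨ sum-cong-≋ {m} (λ i → ^-homo-* x s (s * toℕ i)) ⟩
    ∑ {m} (λ i → x ↑ s · x ↑ (s * toℕ i))   ≈⟨ *-distribˡ-sum {m} (x ↑ s) _ ⟨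
    x ↑ s · ⟦ m ⟧^ s                        ∎)

  ⟦⟧-suc : ∀ m → ⟦ suc m ⟧ ≋ 1# ⊹ x · ⟦ m ⟧
  ⟦⟧-suc m = +-congˡ (sym (*-distribˡ-sum {m} x _))

  -- The first `m` powers form `⟦ m ⟧`; the remaining `n` share the factor `x ↑ m`.
  ⟦⟧-+ : ∀ m n → ⟦ m + n ⟧ ≋ ⟦ m ⟧ ⊹ x ↑ m · ⟦ n ⟧
  ⟦⟧-+ zero    n = sym (trans (+-identityˡ _) (*-identityˡ _))
  ⟦⟧-+ (suc m) n = begin
    ⟦ suc (m + n) ⟧                          ≈⟨ ⟦⟧-suc (m + n) ⟩
    1# ⊹ x · ⟦ m + n ⟧                       ≈⟨ +-congˡ (*-congˡ (⟦⟧-+ m n)) ⟩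
    1# ⊹ x · (⟦ m ⟧ ⊹ x ↑ m · ⟦ n ⟧)         ≈⟨ +-congˡ (distribˡ _ _ _) ⟩
    1# ⊹ (x · ⟦ m ⟧ ⊹ x · (x ↑ m · ⟦ n ⟧))   ≈⟨ +-assoc _ _ _ ⟨
    1# ⊹ x · ⟦ m ⟧ ⊹ x · (x ↑ m · ⟦ n ⟧)     ≈⟨ +-cong (⟦⟧-suc m) (*-assoc _ _ _) ⟨
    ⟦ suc m ⟧ ⊹ x ↑ suc m · ⟦ n ⟧            ∎

  -- The exponents below `m * n` fall into `n` blocks of length `m`, starting at the multiples of
  -- `m`.
  ⟦⟧-* : ∀ m n → ⟦ m * n ⟧ ≋ ⟦ m ⟧ · ⟦ n ⟧^ m
  ⟦⟧-* m zero    = trans (reflexive (cong ⟦_⟧ (ℕ.*-zeroʳ m))) (sym (zeroʳ _))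
  ⟦⟧-* m (suc n) = begin
    ⟦ m * suc n ⟧                          ≡⟨ cong ⟦_⟧ (ℕ.*-suc m n) ⟩
    ⟦ m + m * n ⟧                          ≈⟨ ⟦⟧-+ m (m * n) ⟩
    ⟦ m ⟧ ⊹ x ↑ m · ⟦ m * n ⟧              ≈⟨ +-congˡ (*-congˡ (⟦⟧-* m n)) ⟩
    ⟦ m ⟧ ⊹ x ↑ m · (⟦ m ⟧ · ⟦ n ⟧^ m)     ≈⟨ solve 3 (λ u v w → u :+ v :* (u :* w) := u :* (con 1 :+ v :* w))
                                                refl ⟦ m ⟧ (x ↑ m) (⟦ n ⟧^ m) ⟩
    ⟦ m ⟧ · (1# ⊹ x ↑ m · ⟦ n ⟧^ m)        ≈⟨ *-congˡ (⟦⟧^-suc m n) ⟨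
    ⟦ m ⟧ · ⟦ suc n ⟧^ m                   ∎

  ⟦F⟧-split : ∀ {a n} → a ≤ n →
    ⟦ F (n + 1) ⟧ ≋ x ↑ (F (a + 1) * F (n ∸ a + 1)) · ⟦ F (n ∸ a) ⟧^ (F a) · ⟦ F a ⟧
                    ⊹ ⟦ F (a + 1) ⟧^ (F (n ∸ a + 1)) · ⟦ F (n ∸ a + 1) ⟧
  ⟦F⟧-split {a} {n} a≤n = begin
    ⟦ F (n + 1) ⟧                       ≡⟨ cong ⟦_⟧ (F-split a≤n) ⟩
    ⟦ s * t + u * v ⟧                   ≈⟨ ⟦⟧-+ (s * t) (u * v) ⟩
    -- The first product is commuted so that `t` gives the plain bracket and `s` the one in `x ↑ t`:
    -- the plain `⟦ t ⟧` is what the next split acts on.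
    ⟦ s * t ⟧ ⊹ x ↑ (s * t) · ⟦ u * v ⟧ ≈⟨ +-cong (trans (reflexive (cong ⟦_⟧ (ℕ.*-comm s t))) (⟦⟧-* t s))
                                                  (*-congˡ (⟦⟧-* u v)) ⟩
    ⟦ t ⟧ · ⟦ s ⟧^ t ⊹ x ↑ (s * t) · (⟦ u ⟧ · ⟦ v ⟧^ u)
      ≈⟨ solve 5 (λ k l m n o → k :* l :+ m :* (n :* o) := m :* o :* n :+ l :* k)
           refl ⟦ t ⟧ (⟦ s ⟧^ t) (x ↑ (s * t)) ⟦ u ⟧ (⟦ v ⟧^ u) ⟩
    x ↑ (s * t) · ⟦ v ⟧^ u · ⟦ u ⟧ ⊹ ⟦ s ⟧^ t · ⟦ t ⟧ ∎
    where
    s = F (a + 1)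
    t = F (n ∸ a + 1)
    u = F a
    v = F (n ∸ a)

  -- Iterating the split.

  module _ (n a : ℕ) where

    factor : ℕ → A
    factor j = ⟦ F (a + 1) ⟧^ (F (n ∸ j * a + 1))

    partialProduct : ℕ → A
    partialProduct i = ∏ {i} (λ j → factor (suc (toℕ j)))

    power remainder : ℕ → A
    power     i = x ↑ (F (a + 1) * F (n ∸ i * a + 1))
    remainder i = ⟦ F (n ∸ i * a) ⟧^ (F a)

    -- The index is written `i + 1` rather than `suc i` so that this unfolds to the summand of the
    -- theorem.
    summand : ℕ → A
    summand i = power (i + 1) · partialProduct i · remainder (i + 1)

    ⟦F⟧-split-at : ∀ k → suc k * a ≤ n →
      ⟦ F (n ∸ k * a + 1) ⟧ ≋ power (suc k) · remainder (suc k) · ⟦ F a ⟧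
                              ⊹ factor (suc k) · ⟦ F (n ∸ suc k * a + 1) ⟧
    ⟦F⟧-split-at k [1+k]a≤n = subst
      (λ m → ⟦ F (n ∸ k * a + 1) ⟧ ≋ x ↑ (F (a + 1) * F (m + 1)) · ⟦ F m ⟧^ (F a) · ⟦ F a ⟧
                                     ⊹ ⟦ F (a + 1) ⟧^ (F (m + 1)) · ⟦ F (m + 1) ⟧)
      -- `suc k * a` unfolds to `a + k * a`, hence the commutation.
      (≡.trans (ℕ.∸-+-assoc n (k * a) a) (cong (n ∸_) (ℕ.+-comm (k * a) a)))
      (⟦F⟧-split (ℕ.m+n≤o⇒m≤o∸n a [1+k]a≤n))

    -- The state after `suc k` splits. The first split gives the isolated first term, and each of
    -- the `k` others gives one summand and one further factor of the product.
    ⟦F⟧-expand : ∀ k → suc k * a ≤ n →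
      ⟦ F (n + 1) ⟧ ≋ x ↑ (F (a + 1) * F (n ∸ a + 1)) · ⟦ F (n ∸ a) ⟧^ (F a) · ⟦ F a ⟧
                      ⊹ ⟦ F a ⟧ · ∑ {k} (λ i → summand (suc (toℕ i)))
                      ⊹ partialProduct (suc k) · ⟦ F (n ∸ suc k * a + 1) ⟧
    -- After a single split the sum is empty and the product is one factor times `1#`, which account
    -- for `con 0` and `con 1`.
    ⟦F⟧-expand zero 1a≤n rewrite ℕ.*-identityˡ a = trans (⟦F⟧-split 1a≤n)
      (solve 4 (λ t u s r → t :+ s :* r := t :+ u :* con 0 :+ s :* con 1 :* r)
         refl _ _ _ _)
    ⟦F⟧-expand (suc k) h = begin
      ⟦ F (n + 1) ⟧
        ≈⟨ ⟦F⟧-expand k (ℕ.≤-trans (ℕ.m≤n+m (suc k * a) a) h) ⟩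
      T ⊹ ⟦ F a ⟧ · S ⊹ P · ⟦ F (n ∸ suc k * a + 1) ⟧
        ≈⟨ +-congˡ (*-congˡ (⟦F⟧-split-at (suc k) h)) ⟩
      T ⊹ ⟦ F a ⟧ · S ⊹ P · (power (2+ k) · remainder (2+ k) · ⟦ F a ⟧ ⊹ factor (2+ k) · G)
        -- The part of the split carrying `⟦ F a ⟧` joins the sum; the other part lengthens the
        -- product.
        ≈⟨ solve 8 (λ t u s p w r f g → t :+ u :* s :+ p :* (w :* r :* u :+ f :* g)
                                      := t :+ u :* (s :+ w :* p :* r) :+ p :* f :* g)
             refl T ⟦ F a ⟧ S P (power (2+ k)) (remainder (2+ k)) (factor (2+ k)) G ⟩
      T ⊹ ⟦ F a ⟧ · (S ⊹ power (2+ k) · P · remainder (2+ k)) ⊹ P · factor (2+ k) · G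
        -- The split produces the index `suc (suc k)`, while `summand (suc k)` is stated with
        -- `suc k + 1`.
        ≡⟨ cong (λ i → T ⊹ ⟦ F a ⟧ · (S ⊹ power i · P · remainder i) ⊹ P · factor (2+ k) · G)
                (ℕ.+-comm 1 (suc k)) ⟩
      T ⊹ ⟦ F a ⟧ · (S ⊹ summand (suc k)) ⊹ P · factor (2+ k) · G
        ≈⟨ +-cong (+-congˡ (*-congˡ (LastTerm.sum-last +-monoid k (λ i → summand (suc i)))))
                  (*-congʳ (LastTerm.sum-last *-monoid (suc k) (λ j → factor (suc j)))) ⟨
      T ⊹ ⟦ F a ⟧ · ∑ {suc k} (λ i → summand (suc (toℕ i))) ⊹ partialProduct (2+ k) · G ∎
      where
      2+ : ℕ → ℕ
      2+ i = suc (suc i)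
      T = x ↑ (F (a + 1) * F (n ∸ a + 1)) · ⟦ F (n ∸ a) ⟧^ (F a) · ⟦ F a ⟧
      S = ∑ {k} (λ i → summand (suc (toℕ i)))
      P = partialProduct (suc k)
      G = ⟦ F (n ∸ 2+ k * a + 1) ⟧

-- Coefficient lists as a commutative semiring.

≈-sym : ∀ {p r} → p ≈ r → r ≈ p
≈-sym p≈r k = ≡.sym (p≈r k)

≈-trans : ∀ {p r s} → p ≈ r → r ≈ s → p ≈ s
≈-trans p≈r r≈s k = ≡.trans (p≈r k) (r≈s k)

coeff-⊕ : ∀ p r k → coeff (p ⊕ r) k ≡ coeff p k ℤ.+ coeff r k
coeff-⊕ []      r       k       = ≡.sym (ℤ.+-identityˡ _)
coeff-⊕ (c ∷ p) []      k       = ≡.sym (ℤ.+-identityʳ _)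
coeff-⊕ (c ∷ p) (d ∷ r) zero    = ≡.refl
coeff-⊕ (c ∷ p) (d ∷ r) (suc k) = coeff-⊕ p r k

coeff-scale : ∀ c r k → coeff (map (c ℤ.*_) r) k ≡ c ℤ.* coeff r k
coeff-scale c []      k       = ≡.sym (ℤ.*-zeroʳ c)
coeff-scale c (d ∷ r) zero    = ≡.refl
coeff-scale c (d ∷ r) (suc k) = coeff-scale c r k

-- The recursion defining `⊗`, read coefficientwise; it drives the inductions on the left factor
-- below.
coeff-∷⊗ : ∀ c p r k →
  coeff ((c ∷ p) ⊗ r) k ≡ c ℤ.* coeff r k ℤ.+ coeff (0ℤ ∷ p ⊗ r) k
coeff-∷⊗ c p r k = ≡.trans (coeff-⊕ (map (c ℤ.*_) r) (0ℤ ∷ p ⊗ r) k)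
                           (cong (ℤ._+ _) (coeff-scale c r k))

shift-cong : ∀ {p r} → p ≈ r → (0ℤ ∷ p) ≈ (0ℤ ∷ r)
shift-cong p≈r zero    = ≡.refl
shift-cong p≈r (suc k) = p≈r k

⊕-cong : ∀ {p p′ r r′} → p ≈ p′ → r ≈ r′ → (p ⊕ r) ≈ (p′ ⊕ r′)
⊕-cong {p} {p′} {r} {r′} p≈p′ r≈r′ k = begin
  coeff (p ⊕ r) k             ≡⟨ coeff-⊕ p r k ⟩
  coeff p k ℤ.+ coeff r k     ≡⟨ cong₂ ℤ._+_ (p≈p′ k) (r≈r′ k) ⟩
  coeff p′ k ℤ.+ coeff r′ k   ≡⟨ coeff-⊕ p′ r′ k ⟨
  coeff (p′ ⊕ r′) k           ∎
  where open ≡.≡-Reasoning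

⊕-assoc : ∀ p r s → (p ⊕ r ⊕ s) ≈ (p ⊕ (r ⊕ s))
⊕-assoc p r s k
  rewrite coeff-⊕ (p ⊕ r) s k | coeff-⊕ p r k | coeff-⊕ p (r ⊕ s) k | coeff-⊕ r s k
  = ℤ.+-assoc (coeff p k) (coeff r k) (coeff s k)

⊕-comm : ∀ p r → (p ⊕ r) ≈ (r ⊕ p)
⊕-comm p r k rewrite coeff-⊕ p r k | coeff-⊕ r p k = ℤ.+-comm (coeff p k) (coeff r k)

⊕-identityʳ : ∀ p → (p ⊕ []) ≈ p
⊕-identityʳ p = ⊕-comm p []

-- Recursion on `p` works because the left factor is fixed. Two `≈`-equal left factors may differ in
-- length, so `⊗-cong` treats that side through `⊗-comm`.
⊗-congʳ : ∀ p {r r′} → r ≈ r′ → (p ⊗ r) ≈ (p ⊗ r′)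
⊗-congʳ []      r≈r′ k = ≡.refl
⊗-congʳ (c ∷ p) {r} {r′} r≈r′ k = begin
  coeff ((c ∷ p) ⊗ r) k                          ≡⟨ coeff-∷⊗ c p r k ⟩
  c ℤ.* coeff r k ℤ.+ coeff (0ℤ ∷ p ⊗ r) k       ≡⟨ cong₂ (λ u v → c ℤ.* u ℤ.+ v) (r≈r′ k) (shift-cong (⊗-congʳ p r≈r′) k) ⟩
  c ℤ.* coeff r′ k ℤ.+ coeff (0ℤ ∷ p ⊗ r′) k     ≡⟨ coeff-∷⊗ c p r′ k ⟨
  coeff ((c ∷ p) ⊗ r′) k                         ∎
  where open ≡.≡-Reasoning

-- `p ⊗ []` is a list of zeros as long as `p`, so it equals `[]` only up to `≈`.
⊗-zeroʳ : ∀ p → (p ⊗ []) ≈ []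
⊗-zeroʳ []      k       = ≡.refl
⊗-zeroʳ (c ∷ p) zero    = ≡.refl
⊗-zeroʳ (c ∷ p) (suc k) = ⊗-zeroʳ p k

-- The mirror image of `coeff-∷⊗`, expanding along the right factor; comparing the two expansions
-- yields commutativity.
coeff-⊗∷ : ∀ p d s k →
  coeff (p ⊗ (d ∷ s)) k ≡ d ℤ.* coeff p k ℤ.+ coeff (0ℤ ∷ p ⊗ s) k
coeff-⊗∷ []      d s zero    = ≡.sym (≡.trans (ℤ.+-identityʳ _) (ℤ.*-zeroʳ d))
coeff-⊗∷ []      d s (suc k) = ≡.sym (≡.trans (ℤ.+-identityʳ _) (ℤ.*-zeroʳ d))
coeff-⊗∷ (c ∷ p) d s zero    = cong (ℤ._+ 0ℤ) (ℤ.*-comm c d)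
coeff-⊗∷ (c ∷ p) d s (suc k) = begin
  coeff ((c ∷ p) ⊗ (d ∷ s)) (suc k)                      ≡⟨ coeff-∷⊗ c p (d ∷ s) (suc k) ⟩
  c ℤ.* coeff s k ℤ.+ coeff (p ⊗ (d ∷ s)) k              ≡⟨ cong (λ z → c ℤ.* coeff s k ℤ.+ z) (coeff-⊗∷ p d s k) ⟩
  c ℤ.* coeff s k ℤ.+ (d ℤ.* coeff p k ℤ.+ coeff (0ℤ ∷ p ⊗ s) k)
    ≡⟨ swap (c ℤ.* coeff s k) (d ℤ.* coeff p k) _ ⟩
  d ℤ.* coeff p k ℤ.+ (c ℤ.* coeff s k ℤ.+ coeff (0ℤ ∷ p ⊗ s) k)
    ≡⟨ cong (λ z → d ℤ.* coeff p k ℤ.+ z) (coeff-∷⊗ c p s k) ⟨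
  d ℤ.* coeff p k ℤ.+ coeff ((c ∷ p) ⊗ s) k              ∎
  where
  open ≡.≡-Reasoning
  swap : ∀ u v w → u ℤ.+ (v ℤ.+ w) ≡ v ℤ.+ (u ℤ.+ w)
  swap = ℤ-Solver.solve-∀

⊗-comm : ∀ p r → (p ⊗ r) ≈ (r ⊗ p)
⊗-comm []      r = ≈-sym {r ⊗ []} {[]} (⊗-zeroʳ r)
⊗-comm (c ∷ p) r k = begin
  coeff ((c ∷ p) ⊗ r) k                       ≡⟨ coeff-∷⊗ c p r k ⟩
  c ℤ.* coeff r k ℤ.+ coeff (0ℤ ∷ p ⊗ r) k    ≡⟨ cong (λ z → c ℤ.* coeff r k ℤ.+ z) (shift-cong (⊗-comm p r) k) ⟩
  c ℤ.* coeff r k ℤ.+ coeff (0ℤ ∷ r ⊗ p) k    ≡⟨ coeff-⊗∷ r c p k ⟨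
  coeff (r ⊗ (c ∷ p)) k                       ∎
  where open ≡.≡-Reasoning

⊗-cong : ∀ {p p′ r r′} → p ≈ p′ → r ≈ r′ → (p ⊗ r) ≈ (p′ ⊗ r′)
⊗-cong {p} {p′} {r} {r′} p≈p′ r≈r′ k = begin
  coeff (p ⊗ r) k     ≡⟨ ⊗-congʳ p r≈r′ k ⟩
  coeff (p ⊗ r′) k    ≡⟨ ⊗-comm p r′ k ⟩
  coeff (r′ ⊗ p) k    ≡⟨ ⊗-congʳ r′ p≈p′ k ⟩
  coeff (r′ ⊗ p′) k   ≡⟨ ⊗-comm r′ p′ k ⟩
  coeff (p′ ⊗ r′) k   ∎
  where open ≡.≡-Reasoning

⊗-distribʳ : ∀ s p r → ((p ⊕ r) ⊗ s) ≈ (p ⊗ s ⊕ r ⊗ s)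
⊗-distribʳ s []      r       k = ≡.refl
⊗-distribʳ s (c ∷ p) []      k = ≡.sym (⊕-identityʳ ((c ∷ p) ⊗ s) k)
⊗-distribʳ s (c ∷ p) (d ∷ r) k = begin
  coeff ((c ℤ.+ d ∷ p ⊕ r) ⊗ s) k
    ≡⟨ coeff-∷⊗ (c ℤ.+ d) (p ⊕ r) s k ⟩
  (c ℤ.+ d) ℤ.* coeff s k ℤ.+ coeff (0ℤ ∷ (p ⊕ r) ⊗ s) k
    ≡⟨ cong (λ z → (c ℤ.+ d) ℤ.* coeff s k ℤ.+ z)
            (≡.trans (shift-cong (⊗-distribʳ s p r) k) (coeff-⊕ (0ℤ ∷ p ⊗ s) (0ℤ ∷ r ⊗ s) k)) ⟩
  (c ℤ.+ d) ℤ.* coeff s k ℤ.+ (coeff (0ℤ ∷ p ⊗ s) k ℤ.+ coeff (0ℤ ∷ r ⊗ s) k)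
    ≡⟨ lemma c d (coeff s k) _ _ ⟩
  (c ℤ.* coeff s k ℤ.+ coeff (0ℤ ∷ p ⊗ s) k) ℤ.+ (d ℤ.* coeff s k ℤ.+ coeff (0ℤ ∷ r ⊗ s) k)
    ≡⟨ cong₂ ℤ._+_ (coeff-∷⊗ c p s k) (coeff-∷⊗ d r s k) ⟨
  coeff ((c ∷ p) ⊗ s) k ℤ.+ coeff ((d ∷ r) ⊗ s) k
    ≡⟨ coeff-⊕ ((c ∷ p) ⊗ s) ((d ∷ r) ⊗ s) k ⟨
  coeff ((c ∷ p) ⊗ s ⊕ (d ∷ r) ⊗ s) k ∎
  where
  open ≡.≡-Reasoning
  lemma : ∀ c d x u v → (c ℤ.+ d) ℤ.* x ℤ.+ (u ℤ.+ v) ≡ (c ℤ.* x ℤ.+ u) ℤ.+ (d ℤ.* x ℤ.+ v)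
  lemma = ℤ-Solver.solve-∀

-- Together with `scale-⊗`, this handles the two summands of `(c ∷ p) ⊗ r` when a third factor is
-- multiplied in, as associativity requires.
shift-⊗ : ∀ p r → ((0ℤ ∷ p) ⊗ r) ≈ (0ℤ ∷ p ⊗ r)
shift-⊗ p r k = ≡.trans (coeff-∷⊗ 0ℤ p r k)
  (≡.trans (cong (ℤ._+ coeff (0ℤ ∷ p ⊗ r) k) (ℤ.*-zeroˡ (coeff r k))) (ℤ.+-identityˡ _))

scale-⊗ : ∀ c p r → (map (c ℤ.*_) p ⊗ r) ≈ map (c ℤ.*_) (p ⊗ r)
scale-⊗ c []      r k = ≡.refl
scale-⊗ c (d ∷ p) r k = begin
  coeff (map (c ℤ.*_) (d ∷ p) ⊗ r) k
    ≡⟨ coeff-∷⊗ (c ℤ.* d) (map (c ℤ.*_) p) r k ⟩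
  c ℤ.* d ℤ.* coeff r k ℤ.+ coeff (0ℤ ∷ map (c ℤ.*_) p ⊗ r) k
    ≡⟨ cong (λ z → c ℤ.* d ℤ.* coeff r k ℤ.+ z) (shift-scale k) ⟩
  c ℤ.* d ℤ.* coeff r k ℤ.+ c ℤ.* coeff (0ℤ ∷ p ⊗ r) k
    ≡⟨ lemma c d (coeff r k) _ ⟩
  c ℤ.* (d ℤ.* coeff r k ℤ.+ coeff (0ℤ ∷ p ⊗ r) k)
    ≡⟨ cong (c ℤ.*_) (coeff-∷⊗ d p r k) ⟨
  c ℤ.* coeff ((d ∷ p) ⊗ r) k
    ≡⟨ coeff-scale c ((d ∷ p) ⊗ r) k ⟨
  coeff (map (c ℤ.*_) ((d ∷ p) ⊗ r)) k ∎
  where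
  open ≡.≡-Reasoning
  lemma : ∀ c d x u → c ℤ.* d ℤ.* x ℤ.+ c ℤ.* u ≡ c ℤ.* (d ℤ.* x ℤ.+ u)
  lemma = ℤ-Solver.solve-∀
  shift-scale : ∀ k → coeff (0ℤ ∷ map (c ℤ.*_) p ⊗ r) k ≡ c ℤ.* coeff (0ℤ ∷ p ⊗ r) k
  shift-scale zero    = ≡.sym (ℤ.*-zeroʳ c)
  shift-scale (suc k) = ≡.trans (scale-⊗ c p r k) (coeff-scale c (p ⊗ r) k)

⊗-assoc : ∀ p r s → (p ⊗ r ⊗ s) ≈ (p ⊗ (r ⊗ s))
⊗-assoc []      r s k = ≡.refl
⊗-assoc (c ∷ p) r s k = begin
  coeff ((map (c ℤ.*_) r ⊕ (0ℤ ∷ p ⊗ r)) ⊗ s) k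
    ≡⟨ ⊗-distribʳ s (map (c ℤ.*_) r) (0ℤ ∷ p ⊗ r) k ⟩
  coeff (map (c ℤ.*_) r ⊗ s ⊕ (0ℤ ∷ p ⊗ r) ⊗ s) k
    ≡⟨ ⊕-cong {map (c ℤ.*_) r ⊗ s} {map (c ℤ.*_) (r ⊗ s)} {(0ℤ ∷ p ⊗ r) ⊗ s} {0ℤ ∷ p ⊗ (r ⊗ s)}
         (scale-⊗ c r s)
         (≈-trans {(0ℤ ∷ p ⊗ r) ⊗ s} {0ℤ ∷ p ⊗ r ⊗ s} {0ℤ ∷ p ⊗ (r ⊗ s)}
            (shift-⊗ (p ⊗ r) s) (shift-cong (⊗-assoc p r s))) k ⟩
  coeff ((c ∷ p) ⊗ (r ⊗ s)) k ∎
  where open ≡.≡-Reasoning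

⊗-identityˡ : ∀ p → ((1ℤ ∷ []) ⊗ p) ≈ p
⊗-identityˡ p k = ≡.trans (coeff-∷⊗ 1ℤ [] p k)
  (≡.trans (cong₂ ℤ._+_ (ℤ.*-identityˡ (coeff p k)) (coeff-0∷[] k)) (ℤ.+-identityʳ _))
  where
  coeff-0∷[] : ∀ k → coeff (0ℤ ∷ []) k ≡ 0ℤ
  coeff-0∷[] zero    = ≡.refl
  coeff-0∷[] (suc k) = ≡.refl

ℤ[q]-commutativeSemiring : CommutativeSemiring 0ℓ 0ℓ
ℤ[q]-commutativeSemiring = record
  { Carrier = ℤ[q]
  ; _≈_     = _≈_
  ; _+_     = _⊕_
  ; _*_     = _⊗_
  ; 0#      = []
  ; 1#      = 1ℤ ∷ []
  -- Only right distributivity and the left zero law are supplied; commutativity of `⊗` yields their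
  -- mirror images.
  ; isCommutativeSemiring = isCommutativeSemiringˡ (record
    { +-isCommutativeMonoid = record
      { isMonoid = record
        { isSemigroup = record
          { isMagma = record
            { isEquivalence = isEquivalence
            ; ∙-cong = λ {p} {p′} {r} {r′} → ⊕-cong {p} {p′} {r} {r′} }
          ; assoc = ⊕-assoc }
        ; identity = (λ p k → ≡.refl) , ⊕-identityʳ }
      ; comm = ⊕-comm }
    ; *-isCommutativeMonoid = record
      { isMonoid = record
        { isSemigroup = record
          { isMagma = record
            { isEquivalence = isEquivalence
            ; ∙-cong = λ {p} {p′} {r} {r′} → ⊗-cong {p} {p′} {r} {r′} }
          ; assoc = ⊗-assoc }
        ; identity = ⊗-identityˡ
                   , λ p → ≈-trans {p ⊗ (1ℤ ∷ [])} {(1ℤ ∷ []) ⊗ p} {p} (⊗-comm p (1ℤ ∷ [])) (⊗-identityˡ p) }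
      ; comm = ⊗-comm }
    ; distribʳ = ⊗-distribʳ
    ; zeroˡ = λ p k → ≡.refl })
  }
  where
  isEquivalence : IsEquivalence _≈_
  isEquivalence = record
    { refl  = λ k → ≡.refl
    ; sym   = λ {p} {r} → ≈-sym {p} {r}
    ; trans = λ {p} {r} {s} → ≈-trans {p} {r} {s} }

-- The identity in `ℤ[q]`.

proposition2p10 : (n a : ℕ) (1≤n : 1 ≤ n) (1≤a : 1 ≤ a) (a≤n : a ≤ n) →
    let ⌊n/a⌋ = _/_ n a {{>-nonZero 1≤a}} in
    [ F (n + 1) ]q
    ≈ q ^ (F (a + 1) * F (n ∸ a + 1)) ⊗ [ F (n ∸ a) ]q^ (F a) ⊗ [ F a ]q
    ⊕ [ F a ]q ⊗ (∑[1≤ i ≤ ⌊n/a⌋ ∸ 1 ]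
    (q ^ (F (a + 1) * F (n ∸ (i + 1) * a + 1))
    ⊗ (∏[1≤ j ≤ i ] ([ F (a + 1) ]q^ (F (n ∸ j * a + 1))))
    ⊗ [ F (n ∸ (i + 1) * a) ]q^ (F a)))
    ⊕ (∏[1≤ j ≤ ⌊n/a⌋ ] ([ F (a + 1) ]q^ (F (n ∸ j * a + 1))))
    ⊗ [ F (n ∸ ⌊n/a⌋ * a + 1) ]q
proposition2p10 n a 1≤n 1≤a a≤n =
  -- Since `a ≤ n`, the quotient is at least 1, so the first split takes place; `n / a * a ≤ n`
  -- permits all the others.
  expand (n / a) (m≥n⇒m/n>0 a≤n) (m/n*n≤m n a)
  where
  instance _ = >-nonZero 1≤a
  -- Replacing the quotient by a variable `N` allows matching on `suc k`, after which `N ∸ 1`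
  -- reduces to `k`; `1 ≤ N` rules out zero.
  expand : ∀ N → 1 ≤ N → N * a ≤ n →
    [ F (n + 1) ]q
    ≈ q ^ (F (a + 1) * F (n ∸ a + 1)) ⊗ [ F (n ∸ a) ]q^ (F a) ⊗ [ F a ]q
    ⊕ [ F a ]q ⊗ (∑[1≤ i ≤ N ∸ 1 ]
    (q ^ (F (a + 1) * F (n ∸ (i + 1) * a + 1))
    ⊗ (∏[1≤ j ≤ i ] ([ F (a + 1) ]q^ (F (n ∸ j * a + 1))))
    ⊗ [ F (n ∸ (i + 1) * a) ]q^ (F a)))
    ⊕ (∏[1≤ j ≤ N ] ([ F (a + 1) ]q^ (F (n ∸ j * a + 1))))
    ⊗ [ F (n ∸ N * a + 1) ]q
  expand (suc k) _ = QFibonacci.⟦F⟧-expand ℤ[q]-commutativeSemiring q n a k
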